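{- Let $n\ge2$. Let $A_1=\{1\text{ - }23\}$, $A_2=\{2\text{ - }13,21\text{ - }3\}$, $A_3=\{1\text{ - }32,13\text{ - }2\}$, $A_4=\{3\text{ - }12,31\text{ - }2\}$. For every choice of $p_i\in A_i$ ($i=1,2,3,4$), $|S_n(p_1,p_2,p_3,p_4)|=2$ and $$S_n(p_1,p_2,p_3,p_4)=\{\,n\,(n-1)\ldots 3\,2\,1,\ \ (n-1)\,n\,(n-2)\,(n-3)\ldots 2\,1\,\}.$$
   Context: $S_n$ is the set of permutations $\pi=\pi_1\pi_2\cdots\pi_n$ of $\{1,\dots,n\}$ (written in one-line notation). For $abc$ a permutation of $123$, the generalized pattern $a\text{ - }bc$ is contained in $\pi$ if there are indices $i<j$ with $j+1\le n$ such that $\pi_i\pi_j\pi_{j+1}$ is order-isomorphic to $abc$; the generalized pattern $ab\text{ - }c$ is contained in $\pi$ if there are indices $i,k$ with $i+1<k\le n$ such that $\pi_i\pi_{i+1}\pi_k$ is order-isomorphic to $abc$. $\pi$ avoids a pattern if it does not contain it. $S_n(p_1,\dots,p_m)$ is the set of $\pi\in S_n$ avoiding all of $p_1,\dots,p_m$. -}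

module Defs where

open import Data.Fin using (Fin; toℕ) renaming (_<_ to _<ᶠ_)
open import Data.List using (List; []; _∷_; lookup; applyUpTo; applyDownFrom)
open import Data.List.Relation.Binary.Permutation.Propositional using (_↭_)
open import Data.List.Relation.Unary.All using (All)
open import Data.Nat using (ℕ; suc; _∸_; _<_)
open import Data.Product using (_×_; ∃; ∃-syntax; proj₁)
open import Data.Vec as Vec using (Vec)
open import Function.Bundles using (_⇔_; Inverse)
open import Relation.Binary.Bundles using (Setoid)
import Relation.Binary.Construct.On as On
open import Relation.Binary.PropositionalEquality using (_≡_; setoid)
open import Relation.Nullary using (¬_)
open import Relation.Unary using (Pred)
open import Level using (0ℓ)

-- A permutation of {1,…,n} is its one-line notation, a word over ℕ;
-- applyUpTo suc n is the word 1 2 … n.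
IsPermutation : ℕ → Pred (List ℕ) 0ℓ
IsPermutation n w = w ↭ applyUpTo suc n

OrderIsomorphic : ∀ {m} → Vec ℕ m → Vec ℕ m → Set
OrderIsomorphic u v =
  ∀ s t → (Vec.lookup u s < Vec.lookup u t) ⇔ (Vec.lookup v s < Vec.lookup v t)

-- a - b ⌢ c is the generalized pattern a-bc and a ⌢ b - c is ab-c: letters
-- joined by ⌢ must occupy adjacent positions. Only patterns in which abc is a
-- permutation of 123 are ever used.
data Pattern : Set where
  _-_⌢_ : (a b c : ℕ) → Pattern
  _⌢_-_ : (a b c : ℕ) → Pattern

triple : {A : Set} → A → A → A → Vec A 3
triple x y z = x Vec.∷ y Vec.∷ z Vec.∷ Vec.[]

Adjacent : ∀ {n} → Fin n → Fin n → Set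
Adjacent i j = toℕ j ≡ suc (toℕ i)

_Contains_ : List ℕ → Pattern → Set
w Contains (a - b ⌢ c) =
  ∃[ i ] ∃[ j ] ∃[ k ] i <ᶠ j × Adjacent j k ×
    OrderIsomorphic (triple (lookup w i) (lookup w j) (lookup w k)) (triple a b c)
w Contains (a ⌢ b - c) =
  ∃[ i ] ∃[ j ] ∃[ k ] Adjacent i j × j <ᶠ k ×
    OrderIsomorphic (triple (lookup w i) (lookup w j) (lookup w k)) (triple a b c)

_Avoids_ : List ℕ → Pattern → Set
w Avoids p = ¬ (w Contains p)

S : ℕ → List Pattern → Pred (List ℕ) 0ℓ
S n ps w = IsPermutation n w × All (w Avoids_) ps

-- Elements of P up to equality of the underlying words, so that distinct
-- membership proofs for one word are not counted separately.
elements : Pred (List ℕ) 0ℓ → Setoid 0ℓ 0ℓ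
elements P = On.setoid {B = ∃ P} (setoid (List ℕ)) proj₁

HasCardinality : Pred (List ℕ) 0ℓ → ℕ → Set
HasCardinality P k = Inverse (elements P) (setoid (Fin k))

A₁ A₂ A₃ A₄ : List Pattern
A₁ = (1 - 2 ⌢ 3) ∷ []
A₂ = (2 - 1 ⌢ 3) ∷ (2 ⌢ 1 - 3) ∷ []
A₃ = (1 - 3 ⌢ 2) ∷ (1 ⌢ 3 - 2) ∷ []
A₄ = (3 - 1 ⌢ 2) ∷ (3 ⌢ 1 - 2) ∷ []

-- n (n−1) … 2 1
decreasing : ℕ → List ℕ
decreasing n = applyDownFrom suc n

-- (n−1) n (n−2) (n−3) … 2 1, meaningful for n ≥ 2
swappedDecreasing : ℕ → List ℕ
swappedDecreasing n = (n ∸ 1) ∷ n ∷ decreasing (n ∸ 2)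

-- Three consecutive letters of an avoiding permutation are in the order 321 or
-- 231, since each of the other four patterns is forbidden whichever of a-bc and
-- ab-c is chosen. So the word stays strictly decreasing when either of its first
-- two letters is removed, which leaves only the order of those two letters free.
-- Conversely, in both resulting words the last of any three letters is the
-- smallest, whereas every forbidden pattern ends in a letter larger than another.
module Submission where

open import Defs
open import Data.Fin using (zero; suc) renaming (_<_ to _<ᶠ_)
import Data.Fin.Properties as Fin
open import Data.List using (List; []; _∷_; length; lookup; map; applyUpTo)
open import Data.List.Membership.Propositional using (_∈_)
open import Data.List.Membership.Propositional.Properties using (∈-lookup)
open import Data.List.Properties using (reverse-applyUpTo)
open import Data.List.Relation.Binary.Equality.Propositional using (≋⇒≡)
open import Data.List.Relation.Binary.Permutation.Propositional
  using (_↭_; ↭-refl; ↭-sym; ↭-trans; ↭-reflexive; ↭-swap; ↭⇒↭ₛ)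
open import Data.List.Relation.Binary.Permutation.Propositional.Properties
  using (↭-reverse; ↭-length)
open import Data.List.Relation.Binary.Permutation.Setoid.Properties
  using (Unique-resp-↭)
open import Data.List.Relation.Unary.All as All using (All; []; _∷_)
import Data.List.Relation.Unary.All.Properties as All
open import Data.List.Relation.Unary.AllPairs as AllPairs using (AllPairs; []; _∷_)
import Data.List.Relation.Unary.AllPairs.Properties as AllPairs
open import Data.List.Relation.Unary.Any using (here; there; index)
open import Data.List.Relation.Unary.Any.Properties using (lookup-index)
open import Data.List.Relation.Unary.Linked as Linked using (Linked; [-]; _∷_)
open import Data.List.Relation.Unary.Linked.Properties using (AllPairs⇒Linked)
open import Data.List.Relation.Unary.Sorted.TotalOrder.Properties using (↗↭↗⇒≋)
open import Data.List.Relation.Unary.Unique.Propositional using (Unique)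
import Data.List.Relation.Unary.Unique.Propositional.Properties as Unique
open import Data.Nat using (ℕ; suc; _≤_; _<_; _>_; s≤s; z<s; s<s)
open import Data.Nat.Properties
  using (≤-reflexive; <-trans; <-asym; <-irrefl; <-cmp; <⇒≤; <⇒≢; suc-injective;
         ≤-totalOrder)
open import Data.Product using (_×_; _,_; ∃-syntax)
open import Data.Sum using (_⊎_; inj₁; inj₂; swap)
open import Data.Vec using (Vec)
open import Function using (_∘_; flip)
open import Function.Bundles using (_⇔_; mk⇔; Equivalence)
open import Relation.Binary.Construct.Flip.EqAndOrd using (totalOrder)
open import Relation.Binary.Core using (Rel)
open import Relation.Binary.Definitions using (tri<; tri≈; tri>)
open import Relation.Binary.PropositionalEquality
  using (_≡_; _≢_; refl; sym; trans; cong; subst; setoid)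
open import Relation.Nullary using (¬_; contradiction)
open import Relation.Unary using (_≐_)
open import Level using (0ℓ)

AllPairs-lookup : ∀ {A : Set} {R : Rel A 0ℓ} {xs} → AllPairs R xs →
  ∀ {i j} → i <ᶠ j → R (lookup xs i) (lookup xs j)
AllPairs-lookup (rs ∷ _)  {zero}  {suc j} _         = All.lookup rs (∈-lookup j)
AllPairs-lookup (_ ∷ rss) {suc i} {suc j} (s≤s i<j) = AllPairs-lookup rss i<j

lookup-injective : ∀ {A : Set} {xs : List A} → Unique xs →
  ∀ {i j} → lookup xs i ≡ lookup xs j → i ≡ j
lookup-injective u {i} {j} eq with Fin.<-cmp i j
... | tri< i<j _ _ = contradiction eq (AllPairs-lookup u i<j)
... | tri≈ _ i≡j _ = i≡j
... | tri> _ _ j<i = contradiction (sym eq) (AllPairs-lookup u j<i)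

-- Words are sent to their positions in `xs`. Equality in `elements P` ignores membership proofs, so
-- the position must not depend on the proof; `index-unique` gets this from the distinctness of the
-- entries.
enumeration⇒cardinality : ∀ {P xs} → Unique xs → P ≐ (_∈ xs) →
  HasCardinality P (length xs)
enumeration⇒cardinality {P} {xs} u (P⊆xs , xs⊆P) = record
  { to        = λ (_ , p) → index (P⊆xs p)
  ; from      = λ i → lookup xs i , xs⊆P (∈-lookup i)
  ; to-cong   = λ {(_ , p)} {(_ , q)} w≡w′ → index-unique p (trans w≡w′ (lookup-index (P⊆xs q)))
  ; from-cong = cong (lookup xs)
  ; inverse   = (λ {_} {(_ , p)} → index-unique p)
              , (λ {(_ , p)} → λ { refl → sym (lookup-index (P⊆xs p)) })
  }
  where
  index-unique : ∀ {w i} (p : P w) → w ≡ lookup xs i → index (P⊆xs p) ≡ i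
  index-unique p eq = lookup-injective u (trans (sym (lookup-index (P⊆xs p))) eq)

-- Ties are excluded: either alternative decides both `x < y` and `y < x`, so three instances, with
-- irreflexivity, settle all nine comparisons of an order isomorphism.
SameOrder : (x y a b : ℕ) → Set
SameOrder x y a b = (x < y × a < b) ⊎ (y < x × b < a)

orderIsomorphic : ∀ {x y z a b c} →
  SameOrder x y a b → SameOrder x z a c → SameOrder y z b c →
  OrderIsomorphic (triple x y z) (triple a b c)
orderIsomorphic xy xz yz = λ where
    zero             zero             → same
    zero             (suc zero)       → agree xy
    zero             (suc (suc zero)) → agree xz
    (suc zero)       zero             → agree (swap xy)
    (suc zero)       (suc zero)       → same
    (suc zero)       (suc (suc zero)) → agree yz
    (suc (suc zero)) zero             → agree (swap xz)
    (suc (suc zero)) (suc zero)       → agree (swap yz)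
    (suc (suc zero)) (suc (suc zero)) → same
  where
  same : ∀ {x a} → (x < x) ⇔ (a < a)
  same = mk⇔ (flip contradiction (<-irrefl refl)) (flip contradiction (<-irrefl refl))
  agree : ∀ {x y a b} → SameOrder x y a b → (x < y) ⇔ (a < b)
  agree (inj₁ (x<y , a<b)) = mk⇔ (λ _ → a<b) (λ _ → x<y)
  agree (inj₂ (y<x , b<a)) =
    mk⇔ (flip contradiction (<-asym y<x)) (flip contradiction (<-asym b<a))

letters : Pattern → Vec ℕ 3
letters (a - b ⌢ c) = triple a b c
letters (a ⌢ b - c) = triple a b c

-- A dash allows a gap without forcing one, so consecutive letters serve both kinds of pattern.
consecutive⇒contains : ∀ p {x y z w} → OrderIsomorphic (triple x y z) (letters p) →
  (x ∷ y ∷ z ∷ w) Contains p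
consecutive⇒contains (_ - _ ⌢ _) iso = zero , suc zero , suc (suc zero) , z<s , refl , iso
consecutive⇒contains (_ ⌢ _ - _) iso = zero , suc zero , suc (suc zero) , refl , s<s z<s , iso

contains⇒subsequence : ∀ p {w} → w Contains p →
  ∃[ i ] ∃[ j ] ∃[ k ] i <ᶠ j × j <ᶠ k ×
    OrderIsomorphic (triple (lookup w i) (lookup w j) (lookup w k)) (letters p)
contains⇒subsequence (_ - _ ⌢ _) (i , j , k , i<j , adj , iso) =
  i , j , k , i<j , ≤-reflexive (sym adj) , iso
contains⇒subsequence (_ ⌢ _ - _) (i , j , k , adj , j<k , iso) =
  i , j , k , ≤-reflexive (sym adj) , j<k , iso

avoids-tail : ∀ {p x w} → (x ∷ w) Avoids p → w Avoids p
avoids-tail {_ - _ ⌢ _} av (i , j , k , i<j , adj , iso) =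
  av (suc i , suc j , suc k , s<s i<j , cong suc adj , iso)
avoids-tail {_ ⌢ _ - _} av (i , j , k , adj , j<k , iso) =
  av (suc i , suc j , suc k , cong suc adj , s<s j<k , iso)

-- The permutations of 123 that do not end in 1, in the order of `A₁` to `A₄`.
forbidden : List (Vec ℕ 3)
forbidden = triple 1 2 3 ∷ triple 2 1 3 ∷ triple 1 3 2 ∷ triple 3 1 2 ∷ []

-- Members of one set differ only in the place of the dash, which `letters` forgets. This equation
-- is all that `S≐two` is told about the choice.
letters-choice : ∀ {p₁ p₂ p₃ p₄} → p₁ ∈ A₁ → p₂ ∈ A₂ → p₃ ∈ A₃ → p₄ ∈ A₄ →
  map letters (p₁ ∷ p₂ ∷ p₃ ∷ p₄ ∷ []) ≡ forbidden
letters-choice {p₁} {p₂} {p₃} {p₄} p₁∈ p₂∈ p₃∈ p₄∈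
  rewrite All.lookup {P = λ p → letters p ≡ triple 1 2 3} (refl ∷ []) p₁∈
        | All.lookup {P = λ p → letters p ≡ triple 2 1 3} (refl ∷ refl ∷ []) p₂∈
        | All.lookup {P = λ p → letters p ≡ triple 1 3 2} (refl ∷ refl ∷ []) p₃∈
        | All.lookup {P = λ p → letters p ≡ triple 3 1 2} (refl ∷ refl ∷ []) p₄∈
  = refl

-- The isomorphism carries a comparison with the last letter back to `x`, `y`, `z`. The first letter
-- serves for 123, 213 and 132; only 312 requires the second.
last-smallest⇒not-forbidden :
  All (λ u → ∀ {x y z} → z < x → z < y → ¬ OrderIsomorphic (triple x y z) u) forbidden
last-smallest⇒not-forbidden =
    (λ z<x _ iso → <-asym z<x (from (iso zero (suc (suc zero))) (s<s z<s)))
  ∷ (λ z<x _ iso → <-asym z<x (from (iso zero (suc (suc zero))) (s<s (s<s z<s))))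
  ∷ (λ z<x _ iso → <-asym z<x (from (iso zero (suc (suc zero))) (s<s z<s)))
  ∷ (λ _ z<y iso → <-asym z<y (from (iso (suc zero) (suc (suc zero))) (s<s z<s)))
  ∷ []
  where open Equivalence using (from)

-- If `z` lies between `x` and `y`, transitivity orders those two and gives 132 or 312. If `z` is
-- the largest, a third comparison separates 123 from 213.
not-forbidden⇒last-smallest : ∀ {x y z} → Unique (x ∷ y ∷ z ∷ []) →
  All (λ u → ¬ OrderIsomorphic (triple x y z) u) forbidden → z < x × z < y
not-forbidden⇒last-smallest {x} {y} {z}
  ((x≢y ∷ x≢z ∷ []) ∷ (y≢z ∷ []) ∷ _) (¬123 ∷ ¬213 ∷ ¬132 ∷ ¬312 ∷ [])
  with <-cmp x z | <-cmp y z
... | tri≈ _ x≡z _ | _            = contradiction x≡z x≢z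
... | _            | tri≈ _ y≡z _ = contradiction y≡z y≢z
... | tri> _ _ z<x | tri> _ _ z<y = z<x , z<y
... | tri< x<z _ _ | tri> _ _ z<y = contradiction
  (orderIsomorphic (inj₁ (<-trans x<z z<y , s<s z<s)) (inj₁ (x<z , s<s z<s))
    (inj₂ (z<y , s<s (s<s z<s)))) ¬132
... | tri> _ _ z<x | tri< y<z _ _ = contradiction
  (orderIsomorphic (inj₂ (<-trans y<z z<x , s<s z<s)) (inj₂ (z<x , s<s (s<s z<s)))
    (inj₁ (y<z , s<s z<s))) ¬312
... | tri< x<z _ _ | tri< y<z _ _ with <-cmp x y
...   | tri≈ _ x≡y _ = contradiction x≡y x≢y
...   | tri< x<y _ _ = contradiction
  (orderIsomorphic (inj₁ (x<y , s<s z<s)) (inj₁ (x<z , s<s z<s))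
    (inj₁ (y<z , s<s (s<s z<s)))) ¬123
...   | tri> _ _ y<x = contradiction
  (orderIsomorphic (inj₂ (y<x , s<s z<s)) (inj₁ (x<z , s<s (s<s z<s)))
    (inj₁ (y<z , s<s z<s))) ¬213

-- Induction on the word: the recursive call on the tail yields a descending chain from `z`, and the
-- first three letters allow it to be extended by `x` or by `y`.
avoids⇒descending : ∀ {ps} → map letters ps ≡ forbidden →
  ∀ {x y} w → Unique (x ∷ y ∷ w) → All ((x ∷ y ∷ w) Avoids_) ps →
  Linked _>_ (x ∷ w) × Linked _>_ (y ∷ w)
avoids⇒descending eq []      _ _ = [-] , [-]
avoids⇒descending eq (z ∷ w) u@(_ ∷ u′) av =
  let z<x , z<y = not-forbidden⇒last-smallest (Unique.take⁺ 3 u)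
        (subst (All _) eq (All.map⁺ (All.map (λ {p} → _∘ consecutive⇒contains p) av)))
      _ , desc = avoids⇒descending eq w u′ (All.map (λ {p} → avoids-tail {p}) av)
  in z<x ∷ desc , z<y ∷ desc

-- An occurrence may be spread over the word, so all pairs are compared, not only neighbours. Its
-- third letter lies beyond both `x` and `y`, so these two are never compared with each other.
descending⇒avoids : ∀ {ps} → map letters ps ≡ forbidden →
  ∀ {x y w} → AllPairs _>_ (x ∷ w) → AllPairs _>_ (y ∷ w) →
  All ((x ∷ y ∷ w) Avoids_) ps
descending⇒avoids {ps} eq {x} {y} {w} x>w y>w =
  All.map (λ {p} → avoids p) (All.map⁻ (subst (All _) (sym eq) last-smallest⇒not-forbidden))
  where
  last-smallest : ∀ i j k → i <ᶠ j → j <ᶠ k → let v = lookup (x ∷ y ∷ w) in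
    v k < v i × v k < v j
  -- Removing `y` shifts later positions: entry `suc (suc k)` of the whole word is entry `suc k` of
  -- `x ∷ w`.
  last-smallest zero (suc zero) (suc (suc k)) _ _ =
    AllPairs-lookup x>w {zero} {suc k} z<s , AllPairs-lookup y>w {zero} {suc k} z<s
  last-smallest zero (suc (suc j)) (suc (suc k)) _ (s≤s j<k) =
    AllPairs-lookup x>w {zero} {suc k} z<s , AllPairs-lookup y>w j<k
  last-smallest (suc i) (suc j) (suc k) (s≤s i<j) (s≤s j<k) =
    AllPairs-lookup y>w (<-trans i<j j<k) , AllPairs-lookup y>w j<k
  last-smallest zero (suc zero) (suc zero) _ (s≤s ())
  last-smallest zero (suc (suc j)) (suc zero) _ (s≤s ())

  avoids : ∀ p → (∀ {x y z} → z < x → z < y → ¬ OrderIsomorphic (triple x y z) (letters p)) →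
    (x ∷ y ∷ w) Avoids p
  avoids p ¬iso c =
    let i , j , k , i<j , j<k , iso = contains⇒subsequence p c
        k<i , k<j = last-smallest i j k i<j j<k
    in ¬iso k<i k<j iso

decreasing-isPermutation : ∀ n → IsPermutation n (decreasing n)
decreasing-isPermutation n =
  ↭-trans (↭-reflexive (sym (reverse-applyUpTo suc n))) (↭-reverse (applyUpTo suc n))

isPermutation⇒unique : ∀ n {w} → IsPermutation n w → Unique w
isPermutation⇒unique n π = Unique-resp-↭ (setoid ℕ) (↭⇒↭ₛ (↭-sym π))
  (Unique.applyUpTo⁺₁ suc n (λ i<j _ → <⇒≢ i<j ∘ suc-injective))

decreasing-descending : ∀ n → AllPairs _>_ (decreasing n)
decreasing-descending n = AllPairs.applyDownFrom⁺₁ suc n (λ j<i _ → s<s j<i)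

-- Sorted lists that are permutations of each other coincide; descending means sorted for the
-- flipped order on ℕ.
descending-isPermutation : ∀ n {w} → Linked _>_ w → IsPermutation n w → w ≡ decreasing n
descending-isPermutation n w> π = ≋⇒≡ (↗↭↗⇒≋ (totalOrder ≤-totalOrder)
  (Linked.map <⇒≤ w>)
  (Linked.map <⇒≤ (AllPairs⇒Linked (decreasing-descending n)))
  (↭⇒↭ₛ (↭-trans π (↭-sym (decreasing-isPermutation n)))))

swap-heads : ∀ {A : Set} {x y a b : A} {v w : List A} →
  _≡_ {A = List A} (y ∷ x ∷ w) (b ∷ a ∷ v) → _≡_ {A = List A} (x ∷ y ∷ w) (a ∷ b ∷ v)
swap-heads refl = refl

S≐two : ∀ m {ps} → map letters ps ≡ forbidden → let n = suc (suc m) in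
  S n ps ≐ (_∈ (decreasing n ∷ swappedDecreasing n ∷ []))
S≐two m {ps} eq = S⊆two , two⊆S
  where
  n = suc (suc m)

  descending⇒∈two : ∀ {x y w} → x ≢ y → Linked _>_ (x ∷ w) → Linked _>_ (y ∷ w) →
    IsPermutation n (x ∷ y ∷ w) → (x ∷ y ∷ w) ∈ (decreasing n ∷ swappedDecreasing n ∷ [])
  descending⇒∈two {x} {y} x≢y x>w y>w π with <-cmp x y
  ... | tri≈ _ x≡y _ = contradiction x≡y x≢y
  ... | tri> _ _ y<x = here (descending-isPermutation n (y<x ∷ y>w) π)
  -- Here `y ∷ x ∷ w` is descending, hence equal to `decreasing n`; exchanging the two leading
  -- letters back gives `swappedDecreasing n`.
  ... | tri< x<y _ _ = there (here (swap-heads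
    (descending-isPermutation n (x<y ∷ x>w) (↭-trans (↭-swap y x ↭-refl) π))))

  S⊆two : ∀ {w} → S n ps w → w ∈ (decreasing n ∷ swappedDecreasing n ∷ [])
  S⊆two {[]}        (π , _)  = contradiction (↭-length π) λ ()
  S⊆two {_ ∷ []}    (π , _)  = contradiction (↭-length π) λ ()
  S⊆two {x ∷ y ∷ w} (π , av) =
    let u         = isPermutation⇒unique n π
        x>w , y>w = avoids⇒descending eq w u av
    in descending⇒∈two (All.head (AllPairs.head u)) x>w y>w π

  two⊆S : ∀ {w} → w ∈ (decreasing n ∷ swappedDecreasing n ∷ []) → S n ps w
  two⊆S w∈ with decreasing-descending n
  -- `n> ∷ m>` describes `decreasing n` without its second letter, `n-1>` the same word without its
  -- first. Both words use these two facts, in opposite order.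
  ... | (_ ∷ n>) ∷ n-1>@(_ ∷ m>) with w∈
  ...   | here refl         = decreasing-isPermutation n , descending⇒avoids eq (n> ∷ m>) n-1>
  ...   | there (here refl) =
    ↭-trans (↭-swap _ _ ↭-refl) (decreasing-isPermutation n) , descending⇒avoids eq n-1> (n> ∷ m>)

proposition2p6 : (n : ℕ) → 2 ≤ n →
    ∀ p₁ p₂ p₃ p₄ → p₁ ∈ A₁ → p₂ ∈ A₂ → p₃ ∈ A₃ → p₄ ∈ A₄ →
    HasCardinality (S n (p₁ ∷ p₂ ∷ p₃ ∷ p₄ ∷ [])) 2
    × S n (p₁ ∷ p₂ ∷ p₃ ∷ p₄ ∷ []) ≐ (_∈ (decreasing n ∷ swappedDecreasing n ∷ []))
proposition2p6 (suc (suc m)) (s≤s (s≤s _)) p₁ p₂ p₃ p₄ p₁∈ p₂∈ p₃∈ p₄∈ =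
  -- The two words differ already in their first letters, `suc (suc m)` and `suc m`.
  enumeration⇒cardinality (((λ ()) ∷ []) ∷ [] ∷ []) S≐ , S≐
  where
  S≐ = S≐two m (letters-choice p₁∈ p₂∈ p₃∈ p₄∈)
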